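{- Let $\kappa\leq\lambda$ be infinite cardinals with $\kappa$ regular. Let $\delta$ be a regular (infinite) cardinal such that $\delta\leq\lambda$. Then there is a continuous weak $\delta$-measure space $({}^{\kappa}\lambda,\mathfrak{M},\mu)$ on ${}^{\kappa}\lambda$ with $\mathrm{supp}(\mu)={}^{\kappa}\lambda$ (with $\mu$ taking values in some positively totally ordered monoid $\mathbb{S}$ with an infinitary sum $\mathsf{Sum}$).
   Context: **Topology.** ${}^{\kappa}\lambda$ is the set of sequences of elements of $\lambda$ of length $\kappa$, with the bounded topology, generated by the cones $\mathbf{N}_s=\{x\in{}^{\kappa}\lambda\mid s\subseteq x\}$ for $s\in{}^{<\kappa}\lambda=\bigcup_{\alpha<\kappa}{}^{\alpha}\lambda$. **Monoids and sums.** A positively totally ordered monoid is $\mathbb{S}=(S,0,+,\leq)$ where $+$ is associative (not necessarily commutative) with neutral element $0$, $\leq$ is a total order, $a\leq b$ and $c\leq d$ imply $a+c\leq b+d$, $0$ is the minimum of $\leq$, and $S\neq\{0\}$. ${}^{<\mathrm{On}}\mathbb{S}$ is the class of all sequences of elements of $S$ of ordinal length; $\mathrm{lh}(s)$ is the length of $s$. An infinitary sum on $\mathbb{S}$ is a partial function $\mathsf{Sum}:{}^{<\mathrm{On}}\mathbb{S}\to\mathbb{S}$ such that: (S1) $\mathsf{Sum}(\emptyset)=0$ and $\mathsf{Sum}(s)=s_0+\dots+s_n$ for every non-empty finite $s=(s_i)_{i\leq n}\in\mathrm{dom}(\mathsf{Sum})$; (S2) (continuity) for all $s\in\mathrm{dom}(\mathsf{Sum})$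 of limit length, if $s\restriction\alpha\in\mathrm{dom}(\mathsf{Sum})$ for cofinally many $\alpha<\mathrm{lh}(s)$, then $\mathsf{Sum}(s)=\sup\{\mathsf{Sum}(s\restriction\alpha)\mid\alpha<\mathrm{lh}(s),\ s\restriction\alpha\in\mathrm{dom}(\mathsf{Sum})\}$. **Measures.** A weakly $\delta$-measurable space is a pair $(X,\mathfrak{M})$ where $X$ is a topological space and $\mathfrak{M}$ is a family of subsets of $X$ closed under unions of size $<\delta$ and containing all open subsets of $X$. A $\delta$-measure on it (with values in $(\mathbb{S},\mathsf{Sum})$) is a partial function $\mu:\mathscr{P}(X)\to\mathbb{S}$ with $\mathfrak{M}\subseteq\mathrm{dom}(\mu)$ such that: (M1) $\mu(\emptyset)=0$; (M2) $\mu(X)>0$; (M3) $A\subseteq B$ implies $\mu(A)\leq\mu(B)$ for all $A,B\in\mathfrak{M}$; (M4) for every family $(A_i)_{i<\gamma}$ of pairwise disjoint sets of $\mathfrak{M}$ of length an ordinal $\gamma<\delta$, we have $\langle\mu(A_i)\mid i<\gamma\rangle\in\mathrm{dom}(\mathsf{Sum})$ and $\mu(\bigcup_{i<\gamma}A_i)=\mathsf{Sum}(\langle\mu(A_i)\mid i<\gamma\rangle)$; (M5) for every $x\in X$ with $\{x\}\in\mathfrak{M}$ and every open local basis $\{A_i\mid i<\gamma\}$ at $x$ with $\gamma<\delta$, $\mu(\{x\})=\inf_{i<\gamma}\mu(A_i)$. Then $(X,\mathfrak{M},\mu)$ is called a weak $\delta$-measure space. It is continuous if $\{x\}\in\mathfrak{M}$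 and $\mu(\{x\})=0$ for every $x\in X$. The support of $\mu$ is $\mathrm{supp}(\mu)=X\setminus\bigcup\{O\mid O\text{ open},\ \mu(O)=0\}$. -}

module Defs where

open import Algebra.Bundles using (Monoid)
open import Algebra.Structures using (IsMonoid)
import Algebra.Definitions.RawMonoid as RawMonoidDefs
open import Data.Empty.Polymorphic using (⊥)
open import Data.Fin.Base using (Fin)
import Data.Fin.Base as Fin
open import Data.List.Base using (List; []; _++_)
open import Data.List.Relation.Unary.All using (All; [])
open import Data.List.Relation.Unary.All.Properties using (++⁺; ++⁻ˡ; ++⁻ʳ)
open import Data.Nat.Base using (ℕ)
open import Data.Product using (Σ-syntax; ∃-syntax; _×_; _,_; proj₁; proj₂)
open import Data.Refinement using (Refinement; value; value-injective; _,_)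
open import Data.Unit.Polymorphic using (⊤)
open import Function.Base using (_∘_)
open import Function.Bundles using (_↣_; _⇔_; Equivalence)
open import Induction.WellFounded using (WellFounded)
open import Level using (Level; suc)
open import Relation.Binary.Bundles using (Setoid)
open import Relation.Binary.Core using (Rel)
import Relation.Binary.Construct.NonStrictToStrict as NonStrictToStrict
import Relation.Binary.Construct.On as On
import Relation.Binary.Construct.StrictToNonStrict as StrictToNonStrict
open import Relation.Binary.Definitions using (_Respects_; tri<; tri≈; tri>)
open import Relation.Binary.Morphism.Structures using (IsOrderIsomorphism)
open import Relation.Binary.PropositionalEquality
  using (_≡_; refl; trans; cong; _→-setoid_; isEquivalence; resp₂)
open import Relation.Binary.Structures using (IsStrictTotalOrder; IsTotalOrder)
open import Relation.Nullary using (¬_)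
open import Relation.Unary using (Pred; _∈_; _⊆_; _≐_)

------------------------------------------------------------------------
-- Ordinals and cardinals

-- An ordinal is a well-ordered type; nothing below distinguishes
-- between isomorphic well-orders. Elements of the carrier of α play the
-- role of the ordinals smaller than α.
record Ordinal (ℓ : Level) : Set (suc ℓ) where
  infix 4 _<_ _≤_
  field
    Carrier            : Set ℓ
    _<_                : Rel Carrier ℓ
    isStrictTotalOrder : IsStrictTotalOrder _≡_ _<_
    wellFounded        : WellFounded _<_

  open IsStrictTotalOrder isStrictTotalOrder public using (compare)
    renaming (trans to <-trans)

  _≤_ : Rel Carrier ℓ
  _≤_ = StrictToNonStrict._≤_ _≡_ _<_

  -- The elements below a. Membership is proof-irrelevant, so that two
  -- elements are propositionally equal as soon as their values are.
  Below : Carrier → Set ℓ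
  Below a = Refinement Carrier (_< a)

-- The ordinal a < α itself, that is, the initial segment of α below a.
_↓_ : ∀ {ℓ} (α : Ordinal ℓ) → Ordinal.Carrier α → Ordinal ℓ
α ↓ a = record
  { Carrier            = Below a
  ; _<_                = λ i j → value i < value j
  ; isStrictTotalOrder = record
    { isStrictPartialOrder = record
      { isEquivalence = isEquivalence
      ; irrefl        = λ { refl → irrefl refl }
      ; trans         = <-trans
      ; <-resp-≈      = resp₂ (λ i j → value i < value j)
      }
    ; compare = cmp
    }
  ; wellFounded        = On.wellFounded value wellFounded
  }
  where
  open Ordinal α
  open IsStrictTotalOrder isStrictTotalOrder using (irrefl)
  cmp : ∀ i j → _
  cmp i j with compare (value i) (value j)
  ... | tri< p q r = tri< p (q ∘ cong value) r
  ... | tri≈ p q r = tri≈ p (value-injective q) r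
  ... | tri> p q r = tri> p (q ∘ cong value) r

IsLimit : ∀ {ℓ} → Ordinal ℓ → Set ℓ
IsLimit α = Carrier × (∀ a → ∃[ b ] a < b)
  where open Ordinal α

-- A cardinal is an initial ordinal.
record Cardinal (ℓ : Level) : Set (suc ℓ) where
  field
    ordinal : Ordinal ℓ

  open Ordinal ordinal public

  field
    initial : ∀ a → ¬ (Carrier ↣ Below a)

Infinite : ∀ {ℓ} → Cardinal ℓ → Set ℓ
Infinite κ = ℕ ↣ Cardinal.Carrier κ

infix 4 _≤ᶜ_
_≤ᶜ_ : ∀ {ℓ} → Cardinal ℓ → Cardinal ℓ → Set ℓ
κ ≤ᶜ ν = Cardinal.Carrier κ ↣ Cardinal.Carrier ν

-- An infinite cardinal is regular if it equals its own cofinality: no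
-- map into it from a smaller ordinal is cofinal.
record Regular {ℓ : Level} (κ : Cardinal ℓ) : Set ℓ where
  open Cardinal κ
  field
    infinite  : Infinite κ
    noCofinal : ∀ γ (f : Below γ → Carrier) → ¬ (∀ b → ∃[ i ] b ≤ f i)

------------------------------------------------------------------------
-- Subsets of a setoid

record Subset {ℓ : Level} (X : Setoid ℓ ℓ) : Set (suc ℓ) where
  open Setoid X using (Carrier; _≈_)
  field
    pred : Pred Carrier ℓ
    resp : pred Respects _≈_

open Subset public

module _ {ℓ : Level} {X : Setoid ℓ ℓ} where
  open Setoid X using (Carrier; _≈_)
    renaming (trans to ≈-trans)

  infix 4 _∈ˢ_ _⊆ˢ_ _≐ˢ_

  _∈ˢ_ : Carrier → Subset X → Set ℓ
  x ∈ˢ A = x ∈ pred A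

  _⊆ˢ_ : Rel (Subset X) ℓ
  A ⊆ˢ B = pred A ⊆ pred B

  _≐ˢ_ : Rel (Subset X) ℓ
  A ≐ˢ B = pred A ≐ pred B

  ∅ : Subset X
  ∅ = record { pred = λ _ → ⊥ ; resp = λ _ () }

  full : Subset X
  full = record { pred = λ _ → ⊤ ; resp = λ _ _ → _ }

  ｛_｝ : Carrier → Subset X
  ｛ x ｝ = record { pred = x ≈_ ; resp = λ p q → ≈-trans q p }

  infixr 7 _∩_
  _∩_ : Subset X → Subset X → Subset X
  A ∩ B = record
    { pred = λ x → x ∈ˢ A × x ∈ˢ B
    ; resp = λ { p (a , b) → resp A p a , resp B p b }
    }

  ⋃ : {I : Set ℓ} → (I → Subset X) → Subset X
  ⋃ A = record
    { pred = λ x → ∃[ i ] x ∈ˢ A i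
    ; resp = λ { p (i , a) → i , resp (A i) p a }
    }

  Disjoint : Rel (Subset X) ℓ
  Disjoint A B = ∀ x → ¬ (x ∈ˢ A × x ∈ˢ B)

  -- Stated as a relation because the union of an arbitrary collection of
  -- subsets is a predicate of a higher level than its members.
  _IsUnionOf_ : Subset X → (Subset X → Set (suc ℓ)) → Set (suc ℓ)
  U IsUnionOf 𝒰 = ∀ x → x ∈ˢ U ⇔ (∃[ V ] 𝒰 V × x ∈ˢ V)

------------------------------------------------------------------------
-- Topological spaces

record TopologicalSpace (ℓ : Level) : Set (suc (suc ℓ)) where
  field
    points    : Setoid ℓ ℓ
    Open      : Subset points → Set ℓ
    full-open : Open full
    ∩-open    : ∀ {U V} → Open U → Open V → Open (U ∩ V)
    ⋃-open    : ∀ {U} (𝒰 : Subset points → Set (suc ℓ)) →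
                (∀ {V} → 𝒰 V → Open V) → U IsUnionOf 𝒰 → Open U

  ∅-open : Open ∅
  ∅-open = ⋃-open (λ _ → ⊥) (λ ()) λ x → record
    { to = λ () ; from = λ () ; to-cong = λ { refl → refl } ; from-cong = λ { refl → refl } }

  open Setoid points public using (_≈_) renaming (Carrier to Point)

  record IsLocalBasis {I : Set ℓ} (x : Point) (A : I → Subset points) : Set (suc ℓ) where
    field
      isOpen : ∀ i → Open (A i)
      center : ∀ i → x ∈ˢ A i
      small  : ∀ U → Open U → x ∈ˢ U → ∃[ i ] A i ⊆ˢ U

-- The topology generated by a family (B i) as a subbase: the open sets
-- are the unions of finite intersections of members of the family.
generated : ∀ {ℓ} (X : Setoid ℓ ℓ) {I : Set ℓ} → (I → Subset X) → TopologicalSpace ℓ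
generated X {I} B = record
  { points    = X
  ; Open      = λ U → ∀ {x} → x ∈ˢ U →
                  ∃[ F ] x ∈⋂ F × (∀ {y} → y ∈⋂ F → y ∈ˢ U)
  ; full-open = λ _ → [] , [] , _
  ; ∩-open    = λ u v (xu , xv) →
      let (F , xF , F⊆U) = u xu
          (G , xG , G⊆V) = v xv
      in F ++ G , ++⁺ xF xG , λ y∈ → F⊆U (++⁻ˡ F y∈) , G⊆V (++⁻ʳ F y∈)
  ; ⋃-open    = λ 𝒰 op un {x} xU →
      let (V , V∈𝒰 , xV)   = Equivalence.to (un x) xU
          (F , xF , F⊆V) = op V∈𝒰 xV
      in F , xF , λ {y} y∈ → Equivalence.from (un y) (V , V∈𝒰 , F⊆V y∈)
  }
  where
  _∈⋂_ : Setoid.Carrier X → List I → Set _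
  x ∈⋂ F = All (λ i → x ∈ˢ B i) F

-- The space of sequences of elements of ν of length κ, identified when
-- pointwise equal, with the bounded topology.
module _ {ℓ : Level} (κ ν : Cardinal ℓ) where
  open Cardinal κ using (Below) renaming (Carrier to K)
  open Cardinal ν using () renaming (Carrier to N)

  cone : Σ[ α ∈ K ] (Below α → N) → Subset (K →-setoid N)
  cone (α , s) = record
    { pred = λ x → ∀ i → s i ≡ x (value i)
    ; resp = λ x≈y s⊆x i → trans (s⊆x i) (x≈y (value i))
    }

  sequenceSpace : TopologicalSpace ℓ
  sequenceSpace = generated (K →-setoid N) cone

------------------------------------------------------------------------
-- Positively totally ordered monoids and infinitary sums

record OrderedMonoid (ℓ : Level) : Set (suc ℓ) where
  infix  4 _≈_ _≤_
  infixl 6 _+_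
  field
    Carrier      : Set ℓ
    _≈_          : Rel Carrier ℓ
    _≤_          : Rel Carrier ℓ
    _+_          : Carrier → Carrier → Carrier
    0#           : Carrier
    isMonoid     : IsMonoid _≈_ _+_ 0#
    isTotalOrder : IsTotalOrder _≈_ _≤_
    +-mono-≤     : ∀ {a b c d} → a ≤ b → c ≤ d → a + c ≤ b + d
    0-minimum    : ∀ a → 0# ≤ a
    nontrivial   : ∃[ a ] ¬ (a ≈ 0#)

  monoid : Monoid ℓ ℓ
  monoid = record { isMonoid = isMonoid }

  open RawMonoidDefs (Monoid.rawMonoid monoid) public using (sum)
  open NonStrictToStrict _≈_ _≤_ public using (_<_)

  IsSup : ∀ {i} {I : Set i} → (I → Carrier) → Carrier → Set _
  IsSup f a = (∀ i → f i ≤ a) × (∀ b → (∀ i → f i ≤ b) → a ≤ b)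

  IsInf : ∀ {i} {I : Set i} → (I → Carrier) → Carrier → Set _
  IsInf f a = (∀ i → a ≤ f i) × (∀ b → (∀ i → b ≤ f i) → b ≤ a)

module _ {ℓ : Level} (𝕊 : OrderedMonoid ℓ) where
  private module S = OrderedMonoid 𝕊

  record Sequence : Set (suc ℓ) where
    constructor ⟨_,_⟩
    field
      lh   : Ordinal ℓ
      term : Ordinal.Carrier lh → S.Carrier

    open Ordinal lh public using () renaming (Carrier to Index; _<_ to _<ⁱ_; _≤_ to _≤ⁱ_)

    _↾_ : Index → Sequence
    _↾_ α = record { lh = lh ↓ α ; term = term ∘ value }

  open Sequence using (_↾_)

  -- Equality of sequences: ordinals are well-orders up to isomorphism.
  record _≋_ (s t : Sequence) : Set ℓ where
    private
      module s = Sequence s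
      module t = Sequence t
    field
      reindex : s.Index → t.Index
      isIso   : IsOrderIsomorphism _≡_ _≡_ s._<ⁱ_ t._<ⁱ_ reindex
      equal   : ∀ i → s.term i S.≈ t.term (reindex i)

  -- A partial function is a domain together with a function of an
  -- argument and a proof that it lies in the domain; the congruence law
  -- makes the value independent of this proof.
  record InfinitarySum : Set (suc (suc ℓ)) where
    field
      dom      : Sequence → Set (suc ℓ)
      Sum      : ∀ s → dom s → S.Carrier
      dom-resp : ∀ {s t} → s ≋ t → dom s → dom t
      Sum-cong : ∀ {s t} → s ≋ t → (p : dom s) (q : dom t) → Sum s p S.≈ Sum t q

      empty-dom : ∀ s → ¬ Sequence.Index s → dom s

      -- For n = 0 this reads Sum ∅ = 0.
      Sum-finite : ∀ s (p : dom s) {n} (e : Fin n → Sequence.Index s) →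
                   IsOrderIsomorphism _≡_ _≡_ Fin._<_ (Sequence._<ⁱ_ s) e →
                   Sum s p S.≈ S.sum (Sequence.term s ∘ e)

      continuity : ∀ s (p : dom s) → IsLimit (Sequence.lh s) →
                   (∀ β → ∃[ α ] Sequence._≤ⁱ_ s β α × dom (s ↾ α)) →
                   S.IsSup {I = Σ[ α ∈ Sequence.Index s ] dom (s ↾ α)}
                           (λ (α , q) → Sum (s ↾ α) q) (Sum s p)

------------------------------------------------------------------------
-- Weakly δ-measurable spaces and δ-measures

-- "Of size < δ" means "indexed by an ordinal γ < δ".
record WeaklyMeasurable {ℓ : Level} (δ : Cardinal ℓ) (X : TopologicalSpace ℓ)
       : Set (suc (suc ℓ)) where
  open TopologicalSpace X
  open Cardinal δ using (Below)
  field
    Mble      : Subset points → Set (suc ℓ)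
    Mble-resp : ∀ {A B} → A ≐ˢ B → Mble A → Mble B
    ⋃-mble    : ∀ γ (A : Below γ → Subset points) → (∀ i → Mble (A i)) → Mble (⋃ A)
    open-mble : ∀ {U} → Open U → Mble U

record Measure {ℓ : Level} {δ : Cardinal ℓ} {X : TopologicalSpace ℓ}
               (𝔐 : WeaklyMeasurable δ X)
               {𝕊 : OrderedMonoid ℓ} (Σ𝕊 : InfinitarySum 𝕊)
       : Set (suc (suc ℓ)) where
  open TopologicalSpace X
  open WeaklyMeasurable 𝔐
  open OrderedMonoid 𝕊 using (0#; _<_; IsInf)
    renaming (Carrier to S; _≈_ to _≈ₛ_; _≤_ to _≤ₛ_)
  open InfinitarySum Σ𝕊 using (Sum) renaming (dom to SumDom)
  open Cardinal δ using (Below; ordinal)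
  field
    dom      : Subset points → Set (suc ℓ)
    μ        : ∀ A → dom A → S
    dom-resp : ∀ {A B} → A ≐ˢ B → dom A → dom B
    μ-cong   : ∀ {A B} → A ≐ˢ B → (p : dom A) (q : dom B) → μ A p ≈ₛ μ B q
    Mble⊆dom : ∀ {A} → Mble A → dom A

  μᴹ : ∀ A → Mble A → S
  μᴹ A m = μ A (Mble⊆dom m)

  field
    μ-∅    : μᴹ ∅ (open-mble ∅-open) ≈ₛ 0#
    μ-full : 0# < μᴹ full (open-mble full-open)
    μ-mono : ∀ {A B} (a : Mble A) (b : Mble B) → A ⊆ˢ B → μᴹ A a ≤ₛ μᴹ B b
    μ-add  : ∀ γ (A : Below γ → Subset points) (m : ∀ i → Mble (A i)) →
             (∀ i j → ¬ (i ≡ j) → Disjoint (A i) (A j)) →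
             Σ[ d ∈ SumDom ⟨ ordinal ↓ γ , (λ i → μᴹ (A i) (m i)) ⟩ ]
               μᴹ (⋃ A) (⋃-mble γ A m) ≈ₛ Sum _ d
    μ-inf  : ∀ x (m : Mble ｛ x ｝) γ (A : Below γ → Subset points) →
             (b : IsLocalBasis x A) →
             IsInf (λ i → μᴹ (A i) (open-mble (IsLocalBasis.isOpen b i))) (μᴹ ｛ x ｝ m)

  Continuous : Set (suc ℓ)
  Continuous = ∀ x → Σ[ m ∈ Mble ｛ x ｝ ] μᴹ ｛ x ｝ m ≈ₛ 0#

  supp : Pred Point (suc ℓ)
  supp x = ¬ (∃[ O ] Σ[ o ∈ Open O ] μᴹ O (open-mble o) ≈ₛ 0# × x ∈ˢ O)

{-# OPTIONS --safe #-}

-- The monoid is κ with its order reversed and a new bottom element 0,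
-- with max as addition and sup as infinitary sum, and every set is
-- measurable. Fix z < λ and let the rank of x ∈ ᵏλ be the least α such
-- that x takes the value z beyond α. The measure of A is the least α
-- (largest in the reversed order) for which A contains at least δ
-- points of rank at most α, and 0 if there is none. Additivity holds
-- because δ is regular: if a union of fewer than δ sets has δ points of
-- rank at most α, so does one of them. The cone of x ↾ β contains at
-- most one point of rank at most α < β, so the measures of neighbourhoods
-- of a point tend to 0; but it contains λ ≥ δ points of rank at most β,
-- so its measure is positive.

module Submission where

open import Defs
open import Axiom.ExcludedMiddle using (ExcludedMiddle)
open import Data.Product using (Σ-syntax; _×_)
open import Relation.Unary using (_≐_; U)

import Algebra.Construct.NaturalChoice.Max as Max
open import Data.Fin.Base as Fin using (Fin)
import Data.Irrelevant as Irrelevant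
open import Data.List.Base using (List; []; _∷_; map)
open import Data.List.Relation.Unary.All as All using (All; []; _∷_)
open import Data.Nat.Base using (zero; suc)
open import Data.Product using (∃-syntax; _,_; proj₁; proj₂; map₂)
open import Data.Refinement using (_,_; value)
open import Data.Sum.Base using (inj₁; inj₂)
open import Data.Unit.Polymorphic using (⊤)
open import Function.Base using (_∘_)
open import Function.Bundles using (_⇔_; mk⇔; Equivalence; Injection)
open import Induction.WellFounded using (Acc; acc)
open import Level using (Level)
open import Relation.Binary.Bundles using (TotalOrder)
import Relation.Binary.Construct.Add.Infimum.NonStrict as AddInfimum
import Relation.Binary.Construct.Flip.EqAndOrd as Flip
import Relation.Binary.Construct.StrictToNonStrict as StrictToNonStrict
open import Relation.Binary.Definitions using (tri<; tri≈; tri>)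
open import Relation.Binary.Morphism.Structures using (IsOrderIsomorphism)
open import Relation.Binary.PropositionalEquality
  using (_≡_; _≢_; _≗_; refl; sym; trans; cong; subst)
open import Relation.Binary.Structures using (IsStrictTotalOrder; IsTotalOrder)
open import Relation.Nullary using (¬_; yes; no; contradiction; contradiction-irr)
open import Relation.Nullary.Construct.Add.Infimum using (⊥₋; [_]; _₋)
open import Relation.Unary using (Pred)

private variable
  ℓ : Level

-- Well-orders: least elements and bounds.

module OrdinalOrder (α : Ordinal ℓ) where
  open Ordinal α public
  open IsStrictTotalOrder isStrictTotalOrder public using (irrefl)
  private module NonStrict = StrictToNonStrict _≡_ _<_

  ≤-isTotalOrder : IsTotalOrder _≡_ _≤_
  ≤-isTotalOrder = NonStrict.isTotalOrder isStrictTotalOrder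

  open IsTotalOrder ≤-isTotalOrder public
    using () renaming (refl to ≤-refl; trans to ≤-trans)

  <-≤-trans : ∀ {a b c} → a < b → b ≤ c → a < c
  <-≤-trans a<b (inj₁ b<c)  = <-trans a<b b<c
  <-≤-trans a<b (inj₂ refl) = a<b

  ≤-<-trans : ∀ {a b c} → a ≤ b → b < c → a < c
  ≤-<-trans (inj₁ a<b)  b<c = <-trans a<b b<c
  ≤-<-trans (inj₂ refl) b<c = b<c

  ≮⇒≥ : ∀ {a b} → ¬ (a < b) → b ≤ a
  ≮⇒≥ {a} {b} a≮b with compare a b
  ... | tri< a<b _ _    = contradiction a<b a≮b
  ... | tri≈ _ refl _   = ≤-refl
  ... | tri> _ _ b<a    = inj₁ b<a

  upperBound : Carrier → (F : List Carrier) → ∃[ b ] All (_≤ b) F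
  upperBound a []      = a , []
  upperBound a (c ∷ F) with upperBound a F
  ... | b , F≤b with IsTotalOrder.total ≤-isTotalOrder b c
  ... | inj₁ b≤c = c , ≤-refl ∷ All.map (λ p → ≤-trans p b≤c) F≤b
  ... | inj₂ c≤b = b , c≤b ∷ F≤b

module _ (em : ExcludedMiddle ℓ) (α : Ordinal ℓ) where
  open OrdinalOrder α

  least : (P : Pred Carrier ℓ) → ∃[ a ] P a → ∃[ a ] P a × (∀ b → P b → a ≤ b)
  least P (a , Pa) = go a Pa (wellFounded a)
    where
    go : ∀ a → P a → Acc _<_ a → _
    go a Pa (acc rec) with em {∃[ b ] b < a × P b}
    ... | yes (b , b<a , Pb) = go b Pb (rec b<a)
    ... | no none = a , Pa , λ b Pb → ≮⇒≥ λ b<a → none (b , b<a , Pb)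

  ¬unbounded⇒bounded : (P : Pred Carrier ℓ) →
    ¬ (∀ a → ∃[ b ] a < b × P b) → ∃[ a ] (∀ b → P b → b ≤ a)
  ¬unbounded⇒bounded P ¬unbounded with em {∃[ a ] (∀ b → P b → b ≤ a)}
  ... | yes bounded = bounded
  ... | no ¬bounded = contradiction unbounded ¬unbounded
    where
    unbounded : ∀ a → ∃[ b ] a < b × P b
    unbounded a with em {∃[ b ] a < b × P b}
    ... | yes p = p
    ... | no ¬p = contradiction
      (a , λ b Pb → ≮⇒≥ λ a<b → ¬p (b , a<b , Pb)) ¬bounded

-- Regular cardinals have no last element.

module RegularCardinal (em : ExcludedMiddle ℓ) (κ : Cardinal ℓ) (regular : Regular κ) where
  open OrdinalOrder (Cardinal.ordinal κ)
  open Regular regular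
  open Injection infinite using (to; injective)

  element : Carrier
  element = to 0

  -- If there were b < c, the constant map with value the maximum a on the
  -- non-empty ordinal c would be cofinal.
  maximum⇒minimal : ∀ {a} → ¬ (∃[ b ] a < b) → ∀ {b c} → ¬ (b < c)
  maximum⇒minimal {a} a-max {b} {c} b<c = noCofinal c (λ _ → a) λ d →
    (b , Irrelevant.[ b<c ]) , ≮⇒≥ λ a<d → a-max (d , a<d)

  noMaximum : ∀ a → ∃[ b ] a < b
  noMaximum a with em {∃[ b ] a < b}
  ... | yes p = p
  -- Infinity supplies two distinct elements; one lies strictly below the other, which a maximum
  -- would forbid.
  ... | no a-max with compare (to 0) (to 1)
  ...   | tri≈ _ 0≡1 _ with () ← injective 0≡1
  ...   | tri< 0<1 _ _ = contradiction 0<1 (maximum⇒minimal a-max)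
  ...   | tri> _ _ 1<0 = contradiction 1<0 (maximum⇒minimal a-max)

-- The monoid of values and its infinitary sum.

module ReversedOrdinal (em : ExcludedMiddle ℓ) (κ : Ordinal ℓ) where
  private module κ = OrdinalOrder κ

  Value : Set ℓ
  Value = κ.Carrier ₋

  private module Inf = AddInfimum (λ a b → b κ.≤ a)
  open Inf public using () renaming (_≤₋_ to _≤_)
  open Inf using (⊥₋≤_; [_])

  ≤-isTotalOrder : IsTotalOrder _≡_ _≤_
  ≤-isTotalOrder = Inf.≤₋-isTotalOrder-≡ (Flip.isTotalOrder κ.≤-isTotalOrder)

  open IsTotalOrder ≤-isTotalOrder using (antisym)
    renaming (refl to ≤-refl; trans to ≤-trans)

  ≤-totalOrder : TotalOrder ℓ ℓ ℓ
  ≤-totalOrder = record { isTotalOrder = ≤-isTotalOrder }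

  private module ⊔ = Max ≤-totalOrder

  orderedMonoid : κ.Carrier → OrderedMonoid ℓ
  orderedMonoid a = record
    { _≈_          = _≡_
    ; _≤_          = _≤_
    ; _+_          = ⊔._⊔_
    ; 0#           = ⊥₋
    ; isMonoid     = ⊔.⊔-isMonoid ⊥₋≤_
    ; isTotalOrder = ≤-isTotalOrder
    ; +-mono-≤     = ⊔.⊔-mono-≤
    ; 0-minimum    = ⊥₋≤_
    ; nontrivial   = [ a ] , λ ()
    }

  -- `⊥₋` is below everything, and for `v = [ k ]` the hypothesis applies to `k` itself. Values can
  -- thus be compared through the elements of `κ` below them.
  ≤-ext : ∀ {v w} → (∀ k → [ k ] ≤ v → [ k ] ≤ w) → v ≤ w
  ≤-ext {⊥₋}    v⊆w = ⊥₋≤ _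
  ≤-ext {[ k ]} v⊆w = v⊆w k ≤-refl

  ≡-⊥ : ∀ {v} → (∀ k → ¬ ([ k ] ≤ v)) → v ≡ ⊥₋
  ≡-⊥ none = antisym (≤-ext λ k p → contradiction p (none k)) (⊥₋≤ _)

  -- The values correspond to the upper sets of κ.
  represent : (P : Pred κ.Carrier ℓ) → (∀ {j k} → j κ.≤ k → P j → P k) →
              Σ[ v ∈ Value ] (∀ k → [ k ] ≤ v ⇔ P k)
  represent P up with em {∃[ k ] P k}
  ... | no none = ⊥₋ , λ k → mk⇔ (λ ()) λ Pk → contradiction (k , Pk) none
  ... | yes some with least em κ P some
  ... | m , Pm , m-least =
    [ m ] , λ k → mk⇔ (λ { [ m≤k ] → up m≤k Pm }) (λ Pk → [ m-least k Pk ])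

  module _ {I : Set ℓ} (f : I → Value) where
    private
      represented : Σ[ v ∈ Value ] (∀ k → [ k ] ≤ v ⇔ (∃[ i ] [ k ] ≤ f i))
      represented = represent _ λ j≤k → map₂ (≤-trans [ j≤k ])

    sup : Value
    sup = proj₁ represented

    -- Suprema are attained: in a reversed well-order every non-empty set has a greatest element.
    -- This lets additivity reduce to finding a single large piece.
    ≤-sup⇔ : ∀ k → [ k ] ≤ sup ⇔ (∃[ i ] [ k ] ≤ f i)
    ≤-sup⇔ = proj₂ represented

    ≤-sup : ∀ i → f i ≤ sup
    ≤-sup i = ≤-ext λ k p → Equivalence.from (≤-sup⇔ k) (i , p)

    sup-≤ : ∀ {b} → (∀ i → f i ≤ b) → sup ≤ b
    sup-≤ f≤b = ≤-ext λ k p →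
      let (i , q) = Equivalence.to (≤-sup⇔ k) p in ≤-trans q (f≤b i)

  module _ (a : κ.Carrier) where
    open OrderedMonoid (orderedMonoid a) using (sum)

    ≤-sum : ∀ {n} (f : Fin n → Value) i → f i ≤ sum f
    ≤-sum f Fin.zero    = ⊔.x≤x⊔y (f Fin.zero) (sum (f ∘ Fin.suc))
    ≤-sum f (Fin.suc i) = ≤-trans (≤-sum (f ∘ Fin.suc) i)
      (⊔.x≤y⊔x (f Fin.zero) (sum (f ∘ Fin.suc)))

    sum-≤ : ∀ {n} (f : Fin n → Value) {b} → (∀ i → f i ≤ b) → sum f ≤ b
    sum-≤ {zero}  f f≤b = ⊥₋≤ _
    sum-≤ {suc n} f f≤b =
      ⊔.⊔-lub (f≤b Fin.zero) (sum-≤ (f ∘ Fin.suc) (f≤b ∘ Fin.suc))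

    supremum : InfinitarySum (orderedMonoid a)
    supremum = record
      { dom        = λ _ → ⊤
      ; Sum        = λ s _ → sup (Sequence.term s)
      ; dom-resp   = λ _ _ → _
      ; Sum-cong   = λ {s} {t} s≋t _ _ → Sum-cong s t s≋t
      ; empty-dom  = λ _ _ → _
      ; Sum-finite = λ s _ e iso → antisym
          (sup-≤ _ λ i → let (j , j↦i) = IsOrderIsomorphism.surjective iso i in
            subst (λ k → Sequence.term s k ≤ _) (j↦i refl) (≤-sum _ j))
          (sum-≤ _ λ j → ≤-sup _ (e j))
      ; continuity = λ s _ limit _ →
            (λ (α , _) → sup-≤ _ λ i → ≤-sup _ (value i))
          -- At a limit length every index `i` lies below some `j`, so its term already counts in
          -- the sum up to `j`.
          , λ b ≤b → sup-≤ _ λ i → let (j , i<j) = proj₂ limit i in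
              ≤-trans (≤-sup _ (i , Irrelevant.[ i<j ])) (≤b (j , _))
      }
      where
      Sum-cong : ∀ s t → _≋_ (orderedMonoid a) s t →
                 sup (Sequence.term s) ≡ sup (Sequence.term t)
      Sum-cong s t s≋t = antisym
        (sup-≤ _ λ i → subst (_≤ _) (sym (equal i)) (≤-sup _ (reindex i)))
        (sup-≤ _ λ j → let (i , i↦j) = IsOrderIsomorphism.surjective isIso j in
          subst (_≤ _) (trans (equal i) (cong (Sequence.term t) (i↦j refl))) (≤-sup _ i))
        where open _≋_ s≋t

-- Cones as neighbourhood bases in the bounded topology.

module BoundedTopology (κ ν : Cardinal ℓ) (a : Cardinal.Carrier κ) where
  private module κ = OrdinalOrder (Cardinal.ordinal κ)
  open Cardinal ν using () renaming (Carrier to N)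
  open TopologicalSpace (sequenceSpace κ ν) public using (Open; points)

  coneAt : κ.Carrier → (κ.Carrier → N) → Subset points
  coneAt β x = cone κ ν (β , x ∘ value)

  coneAt-open : ∀ β x → Open (coneAt β x)
  coneAt-open β x y∈ = _ ∷ [] , y∈ ∷ [] , λ { (y∈ ∷ []) → y∈ }

  coneAt-center : ∀ β x → x ∈ˢ coneAt β x
  coneAt-center β x i = refl

  -- Around `x`, an open set contains a finite intersection of cones through `x`; restricting `x` to
  -- a bound of their lengths gives a cone inside all of them.
  coneAt-basis : ∀ {O x} → Open O → x ∈ˢ O → ∃[ β ] coneAt β x ⊆ˢ O
  coneAt-basis {O} {x} o x∈O with o x∈O
  ... | F , x∈F , F⊆O with κ.upperBound a (map proj₁ F)
  ... | β , F≤β = β , λ y∈ → F⊆O (inside F x∈F F≤β y∈)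
    where
    inside : ∀ F → All (λ c → x ∈ˢ cone κ ν c) F →
             All (κ._≤ β) (map proj₁ F) →
             ∀ {y} → y ∈ˢ coneAt β x → All (λ c → y ∈ˢ cone κ ν c) F
    inside []      []          []          y∈ = []
    inside (c ∷ F) (x∈c ∷ x∈F) (α≤β ∷ F≤β) y∈ =
      (λ { i@(k , k<α) → trans (x∈c i)
             (y∈ (k , Irrelevant.map (λ p → κ.<-≤-trans p α≤β) k<α)) })
      ∷ inside F x∈F F≤β y∈

-- Large sets and the measure they define.

module _ (em : ExcludedMiddle ℓ) (κ ν δ : Cardinal ℓ)
         (κ-regular : Regular κ) (δ-regular : Regular δ)
         (δ≤ν : δ ≤ᶜ ν) (z : Cardinal.Carrier ν) where
  private
    module κ where
      open OrdinalOrder (Cardinal.ordinal κ) public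
      open RegularCardinal em κ κ-regular public
    module δ where
      open OrdinalOrder (Cardinal.ordinal δ) public
      open RegularCardinal em δ δ-regular public
      open Regular δ-regular public
    open Cardinal ν using () renaming (Carrier to N)
    open ReversedOrdinal em (Cardinal.ordinal κ)
    open BoundedTopology κ ν κ.element
    open IsTotalOrder ≤-isTotalOrder using (antisym)

  Rank≤ : κ.Carrier → Pred (κ.Carrier → N) ℓ
  Rank≤ α x = ∀ β → α κ.< β → x β ≡ z

  -- A contains δ points of rank at most α. Unboundedly many terms of an
  -- injective δ-sequence are enough, as δ is regular.
  record Large (α : κ.Carrier) (A : Subset points) : Set ℓ where
    field
      point     : δ.Carrier → κ.Carrier → N
      injective : ∀ {d e} → point d ≗ point e → d ≡ e
      unbounded : ∀ d → ∃[ e ] d δ.< e × point e ∈ˢ A × Rank≤ α (point e)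

  Large-mono : ∀ {α β A B} → α κ.≤ β → A ⊆ˢ B → Large α A → Large β B
  Large-mono α≤β A⊆B L = record
    { point     = point
    ; injective = injective
    ; unbounded = λ d → let (e , d<e , e∈A , rank) = unbounded d in
        e , d<e , A⊆B e∈A , λ γ β<γ → rank γ (κ.≤-<-trans α≤β β<γ)
    }
    where open Large L

  -- If no piece were large, the indices of the points of rank at most `α` in each piece would be
  -- bounded in `δ`. As these indices are unbounded for the union, the fewer than `δ` bounds would
  -- be cofinal, against regularity.
  Large-⋃ : ∀ {α} γ (A : δ.Below γ → Subset points) →
            Large α (⋃ A) → ∃[ i ] Large α (A i)
  Large-⋃ {α} γ A L with em {∃[ i ] Large α (A i)}
  ... | yes p   = p
  ... | no none = contradiction cofinal (δ.noCofinal γ (proj₁ ∘ bound))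
    where
    open Large L
    bound : ∀ i → ∃[ b ] (∀ d → point d ∈ˢ A i × Rank≤ α (point d) → d δ.≤ b)
    bound i = ¬unbounded⇒bounded em (Cardinal.ordinal δ) _ λ unboundedᵢ → none (i , record
      { point     = point
      ; injective = injective
      ; unbounded = unboundedᵢ
      })
    cofinal : ∀ d → ∃[ i ] d δ.≤ proj₁ (bound i)
    cofinal d = let (e , d<e , (i , e∈Aᵢ) , rank) = unbounded d in
      i , δ.≤-trans (inj₁ d<e) (proj₂ (bound i) e (e∈Aᵢ , rank))

  -- Unboundedness yields two indices `d < e` whose points lie in `A` with rank at most `α`; were
  -- these points equal, injectivity would give `d = e`.
  subsingleton-¬Large : ∀ {α A} →
    (∀ {x y} → x ∈ˢ A → y ∈ˢ A → Rank≤ α x → Rank≤ α y → x ≗ y) → ¬ Large α A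
  subsingleton-¬Large agree L =
    let (d , _   , d∈A , d-rank) = unbounded δ.element
        (e , d<e , e∈A , e-rank) = unbounded d
    in δ.irrefl (injective (agree d∈A e∈A d-rank e-rank)) d<e
    where open Large L

  -- Points of the cone agree below `β`, and those of rank at most `α` equal `z` from `β` on.
  -- Strictness of `α < β` settles the coordinate `β` itself.
  coneAt-¬Large : ∀ {α β} x → α κ.< β → ¬ Large α (coneAt β x)
  coneAt-¬Large {α} {β} x α<β = subsingleton-¬Large agree
    where
    agree : ∀ {y y′} → y ∈ˢ coneAt β x → y′ ∈ˢ coneAt β x →
            Rank≤ α y → Rank≤ α y′ → y ≗ y′
    agree y∈ y′∈ ry ry′ i with κ.compare i β
    ... | tri< i<β _ _ = let j = i , Irrelevant.[ i<β ] in trans (sym (y∈ j)) (y′∈ j)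
    ... | tri≈ _ refl _ = trans (ry i α<β) (sym (ry′ i α<β))
    ... | tri> _ _ β<i = let α<i = κ.<-trans α<β β<i in trans (ry i α<i) (sym (ry′ i α<i))

  -- The coordinate `β` is constrained neither by the cone nor by the rank: follow `x` below it, put
  -- `z` above it, and let its value run through a copy of `δ` in `ν`.
  coneAt-Large : ∀ β x → Large β (coneAt β x)
  coneAt-Large β x = record
    { point     = λ d → continue (to d)
    ; injective = λ eq → injective (continue-injective (eq β))
    ; unbounded = λ d → map₂ (_, continue-inside , continue-rank) (δ.noMaximum d)
    }
    where
    open Injection δ≤ν using (to; injective)

    continue : N → κ.Carrier → N
    continue n i with κ.compare i β
    ... | tri< _ _ _ = x i
    ... | tri≈ _ _ _ = n
    ... | tri> _ _ _ = z

    continue-injective : ∀ {m n} → continue m β ≡ continue n β → m ≡ n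
    continue-injective eq with κ.compare β β
    ... | tri< β<β _ _ = contradiction β<β (κ.irrefl refl)
    ... | tri≈ _ _ _   = eq
    ... | tri> _ _ β<β = contradiction β<β (κ.irrefl refl)

    continue-inside : ∀ {n} → continue n ∈ˢ coneAt β x
    continue-inside (i , Irrelevant.[ i<β ]) with κ.compare i β
    ... | tri< _ _ _   = refl
    ... | tri≈ i≮β _ _ = contradiction-irr i<β i≮β
    ... | tri> i≮β _ _ = contradiction-irr i<β i≮β

    continue-rank : ∀ {n} → Rank≤ β (continue n)
    continue-rank i β<i with κ.compare i β
    ... | tri< _ _ β≮i = contradiction β<i β≮i
    ... | tri≈ _ _ β≮i = contradiction β<i β≮i
    ... | tri> _ _ _   = refl

  open-Large : ∀ {O x} → Open O → x ∈ˢ O → ∃[ β ] Large β O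
  open-Large {O} {x} o x∈O = let (β , ⊆O) = coneAt-basis {O} o x∈O in
    β , Large-mono κ.≤-refl ⊆O (coneAt-Large β x)

  module _ (A : Subset points) where
    private
      represented : Σ[ v ∈ Value ] (∀ α → [ α ] ≤ v ⇔ Large α A)
      represented = represent (λ α → Large α A) λ α≤β → Large-mono α≤β λ x∈ → x∈

    size : Value
    size = proj₁ represented

    ≤-size⇔ : ∀ α → [ α ] ≤ size ⇔ Large α A
    ≤-size⇔ = proj₂ represented

  size-mono : ∀ {A B} → A ⊆ˢ B → size A ≤ size B
  size-mono {A} {B} A⊆B = ≤-ext λ α →
    Equivalence.from (≤-size⇔ B α) ∘ Large-mono κ.≤-refl A⊆B ∘ Equivalence.to (≤-size⇔ A α)

  size-⊥ : ∀ {A} → (∀ α → ¬ Large α A) → size A ≡ ⊥₋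
  size-⊥ {A} small = ≡-⊥ λ α → small α ∘ Equivalence.to (≤-size⇔ A α)

  size-open : ∀ {O x} → Open O → x ∈ˢ O → size O ≢ ⊥₋
  size-open {O} o x∈O eq with open-Large {O} o x∈O
  ... | β , L with () ← subst ([ β ] ≤_) eq (Equivalence.from (≤-size⇔ O β) L)

  -- Largeness of the union passes to one piece by `Large-⋃`; the converse inequality is
  -- monotonicity.
  size-⋃ : ∀ γ (A : δ.Below γ → Subset points) → size (⋃ A) ≡ sup (size ∘ A)
  size-⋃ γ A = antisym
    (≤-ext λ α p →
      let (i , L) = Large-⋃ γ A (Equivalence.to (≤-size⇔ (⋃ A) α) p)
      in Equivalence.from (≤-sup⇔ _ α) (i , Equivalence.from (≤-size⇔ (A i) α) L))
    (sup-≤ _ λ i → size-mono (i ,_))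

  size-｛｝ : ∀ x → size ｛ x ｝ ≡ ⊥₋
  size-｛｝ x = size-⊥ λ α → subsingleton-¬Large
    λ x≈y x≈y′ _ _ i → trans (sym (x≈y i)) (x≈y′ i)

  allMeasurable : WeaklyMeasurable δ (sequenceSpace κ ν)
  allMeasurable = record
    { Mble      = λ _ → ⊤
    ; Mble-resp = λ _ _ → _
    ; ⋃-mble    = λ _ _ _ → _
    ; open-mble = λ _ → _
    }

  sizeMeasure : Measure allMeasurable (supremum κ.element)
  sizeMeasure = record
    { dom      = λ _ → ⊤
    ; μ        = λ A _ → size A
    ; dom-resp = λ _ _ → _
    ; μ-cong   = λ (A⊆B , B⊆A) _ _ → antisym (size-mono A⊆B) (size-mono B⊆A)
    ; Mble⊆dom = λ _ → _
    ; μ-∅      = size-⊥ λ _ → subsingleton-¬Large λ ()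
    ; μ-full   = AddInfimum.⊥₋≤ _
               -- The constant sequence `z` witnesses that the space is non-empty.
               , size-open {full} {λ _ → z} (λ _ → [] , [] , _) _ ∘ sym
    ; μ-mono   = λ _ _ → size-mono
    ; μ-add    = λ γ A _ _ → _ , size-⋃ γ A
    ; μ-inf    = λ x _ γ A b →
        let open TopologicalSpace.IsLocalBasis b in
          (λ i → size-mono λ {y} x≈y → resp (A i) x≈y (center i))
        -- No `[ α ]` lies below a lower bound `v`: some basis set fits in the cone of `x` at a
        -- `β > α`, and would make that cone large at `α`.
        , λ v v≤ → ≤-ext λ α α≤v →
            let (β , α<β)   = κ.noMaximum α
                (i , Aᵢ⊆)   = small (coneAt β x) (coneAt-open β x) (coneAt-center β x)
                L           = Equivalence.to (≤-size⇔ (A i) α)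
                                (IsTotalOrder.trans ≤-isTotalOrder α≤v (v≤ i))
            in contradiction (Large-mono κ.≤-refl Aᵢ⊆ L) (coneAt-¬Large x α<β)
    }

proposition7p1 : ∀ {ℓ} → ExcludedMiddle ℓ →
    (κ ν δ : Cardinal ℓ) →
    Infinite κ → Infinite ν → κ ≤ᶜ ν → Regular κ →
    Regular δ → δ ≤ᶜ ν →
    Σ[ 𝕊 ∈ OrderedMonoid ℓ ]
    Σ[ Σ𝕊 ∈ InfinitarySum 𝕊 ]
    Σ[ 𝔐 ∈ WeaklyMeasurable δ (sequenceSpace κ ν) ]
    Σ[ 𝓂 ∈ Measure 𝔐 Σ𝕊 ]
    (Measure.Continuous 𝓂 × (Measure.supp 𝓂 ≐ U))
proposition7p1 em κ ν δ _ ν-infinite _ κ-regular δ-regular δ≤ν =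
  _ , _ , _ , sizeMeasure em κ ν δ κ-regular δ-regular δ≤ν z
  , (λ x → _ , size-｛｝ em κ ν δ κ-regular δ-regular δ≤ν z x)
  , _
  , λ _ (O , o , μO≡0 , x∈O) →
      size-open em κ ν δ κ-regular δ-regular δ≤ν z {O} o x∈O μO≡0
  where z = Injection.to ν-infinite 0
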